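{- (Rice, Shapiro) Let $A\subseteq\omega$ be an infinite c.e. set, $n\ge1$, and let $\theta^{(n)}$ be a quasi-Gödel numbering of $\mathcal S^{(n)}_A$. Then a set $X\subseteq\mathcal S^{(n)}_A$ is completely c.e. (i.e. $\{i\in\omega:\theta^{(n)}_i\in X\}$ is c.e.) if, and only if, there is a c.e. set $C\subseteq\omega$ such that $$X=\{\,r\in\mathcal S^{(n)}_A:\ (\exists i\in C)\ \mathrm{graph}(\alpha^{(n)}_i)\subseteq\mathrm{graph}(r)\,\},$$ where $\alpha^{(n)}$ is the canonical one-to-one numbering of $\mathrm{Anf}^{(n)}_A$ described in the context.
   Context: $\omega$ is the set of natural numbers; $\mathcal R^{(n)}$ is the set of total computable functions $\omega^n\to\omega$. $\langle\cdot,\cdot\rangle:\omega^2\to\omega$ is a computable bijection with $\langle x,y\rangle\ge x,y$, extended by $\langle x\rangle=x$, $\langle x_1,\dots,x_{n+1}\rangle=\langle x_1,\langle x_2,\dots,x_{n+1}\rangle\rangle$. $\mathrm{Anf}^{(n)}_A$ is the set of partial functions from $\omega^n$ to $\omega$ whose domain is either empty or equal to $\{0,\dots,a-1\}^n$ for some $a\in A$, and $\mathcal S^{(n)}_A=\mathcal R^{(n)}\cup\mathrm{Anf}^{(n)}_A$. For an $n$-ary partial function $q$, $\mathrm{graph}(q)=\{\langle\langle\vec x\rangle,q(\vec x)\rangle:\vec x\in\mathrm{dom}(q)\}$, and the extended graph of $q$ is $\{\langle\langle\vec y\rangle,0\rangle:\vec y\in\omega^n\}\cup\{\langle\langle\vec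 x\rangle,q(\vec x)+1\rangle:\vec x\in\mathrm{dom}(q)\}$. A numbering of a set $X$ is a surjection $\omega\to X$. A numbering $\theta$ of $\mathcal S^{(n)}_A$ is a quasi-Gödel numbering if: (QGN I) the extended graph of $(i,\vec x)\mapsto\theta_i(\vec x)$ is the range of a function in $\mathcal R^{(1)}$; and (QGN II) for every $k\in\mathcal R^{(2)}$ there is $v\in\mathcal R^{(1)}$ such that for all $i\in\omega$, $r\in\mathcal S^{(n)}_A$: if $\{k(i,t):t\in\omega\}$ is the extended graph of $r$, then $r=\theta_{v(i)}$. Canonical numbering $\alpha^{(n)}$: let $\kappa:\omega\to\omega^n$ be a computable bijection enumerating $\omega^n$ initial segment by initial segment, i.e. $\kappa(c)\in\{0,\dots,a-1\}^n$ iff $c<a^n$. Let $f_A\in\mathcal R^{(1)}$ have range $A$. Fix an effective bijective coding of finite sequences of natural numbers by natural numbers, with $\mathrm{lth}(a)$ the length of the sequence coded by $a$ and $(a)_j$ its $j$-th entry ($1\le j\le\mathrm{lth}(a)$). Put $\widehat\alpha_{\langle a,b\rangle}(\vec x)=(a)_{\kappa^{ -1}(\vec x)+1}$ if $\kappa^{ -1}(\vec x)<\min\{\mathrm{lth}(a),f_A(b)^n\}$; $=0$ if $\mathrm{lth}(a)\le\kappa^{ -1}(\vec x)<f_A(b)^n$; undefined otherwise. Then $\alpha^{(n)}_0$ is the nowhere defined function, and $\alpha^{(n)}_{i+1}=\widehat\alpha_j$ for the least $j$ with $\widehat\alpha_j\notin\{\alpha^{(n)}_0,\dots,\alpha^{(n)}_i\}$.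 -}

module Defs where

open import Data.Empty using (⊥)
open import Data.Fin.Base using (Fin; toℕ)
open import Data.List.Base using (List; length) renaming (lookup to lookupˡ)
open import Data.List.Membership.Propositional using () renaming (_∈_ to _∈ˡ_)
open import Data.Nat.Base using (ℕ; suc; _<_; _≤_; _⊓_; _^_)
open import Data.Nat.Properties using (m⊓n≤m; <-≤-trans; <⇒≱)
open import Data.Product.Base using (Σ-syntax; ∃-syntax; _×_; _,_; proj₁; proj₂)
open import Data.Sum.Base using (_⊎_; inj₁; inj₂)
open import Data.Vec.Base using (Vec; []; _∷_; lookup)
open import Data.Vec.Relation.Unary.All using (All)
open import Function.Bundles using (_↔_; _⇔_; Inverse)
open import Level using (0ℓ)
open import Relation.Binary.Core using () renaming (_⇔_ to _⇔ᵣ_)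
open import Relation.Binary.PropositionalEquality using (_≡_; sym; trans)
open import Relation.Nullary.Negation using (¬_; contradiction)
open import Relation.Unary using (Pred; _∈_; _⊆_; _≐_; _∪_; Empty)

------------------------------------------------------------------------
-- Partial recursive functions

data Code : ℕ → Set where
  zeroᶜ : ∀ {n} → Code n
  sucᶜ  : Code 1
  proj  : ∀ {n} → Fin n → Code n
  comp  : ∀ {m n} → Code m → Vec (Code n) m → Code n
  prec  : ∀ {n} → Code n → Code (suc (suc n)) → Code (suc n)
  mu    : ∀ {n} → Code (suc n) → Code n

infix 4 _[_]↓_

-- c [ xs ]↓ y : the function computed by c is defined at xs, with value y.
-- The recursion variable of prec and the search variable of mu come first;
-- the step function of prec receives the counter and then the previous value.
data _[_]↓_ : ∀ {n} → Code n → Vec ℕ n → ℕ → Set where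
  zero↓ : ∀ {n} {xs : Vec ℕ n} → zeroᶜ [ xs ]↓ 0
  suc↓  : ∀ {x} → sucᶜ [ x ∷ [] ]↓ suc x
  proj↓ : ∀ {n} {xs : Vec ℕ n} (j : Fin n) → proj j [ xs ]↓ lookup xs j
  comp↓ : ∀ {m n} {c : Code m} {ds : Vec (Code n) m} {xs ys z} →
          (∀ j → lookup ds j [ xs ]↓ lookup ys j) →
          c [ ys ]↓ z → comp c ds [ xs ]↓ z
  prec₀ : ∀ {n} {c : Code n} {d xs y} →
          c [ xs ]↓ y → prec c d [ 0 ∷ xs ]↓ y
  prec₊ : ∀ {n} {c : Code n} {d k xs y z} →
          prec c d [ k ∷ xs ]↓ y → d [ k ∷ y ∷ xs ]↓ z →
          prec c d [ suc k ∷ xs ]↓ z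
  mu↓   : ∀ {n} {c : Code (suc n)} {xs y} →
          c [ y ∷ xs ]↓ 0 →
          (∀ k → k < y → ∃[ z ] c [ k ∷ xs ]↓ suc z) →
          mu c [ xs ]↓ y

Computable : ∀ {n} → Pred (Vec ℕ n → ℕ) 0ℓ
Computable {n} f = Σ[ c ∈ Code n ] (∀ xs → c [ xs ]↓ f xs)

Computable₁ : Pred (ℕ → ℕ) 0ℓ
Computable₁ f = Computable {1} λ { (x ∷ []) → f x }

Computable₂ : Pred (ℕ → ℕ → ℕ) 0ℓ
Computable₂ f = Computable {2} λ { (x ∷ y ∷ []) → f x y }

------------------------------------------------------------------------
-- Sets of natural numbers

Range : (ℕ → ℕ) → Pred ℕ 0ℓ
Range f z = ∃[ t ] f t ≡ z

CE : Pred (Pred ℕ 0ℓ) 0ℓ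
CE P = Empty P ⊎ (∃[ f ] Computable₁ f × P ≐ Range f)

Finite Infinite : Pred (Pred ℕ 0ℓ) 0ℓ
Finite P = Σ[ xs ∈ List ℕ ] P ⊆ (_∈ˡ xs)
Infinite P = ¬ Finite P

------------------------------------------------------------------------
-- Partial functions

record PFun (n : ℕ) : Set₁ where
  field
    _↦_        : Vec ℕ n → ℕ → Set
    functional : ∀ {x y z} → x ↦ y → x ↦ z → y ≡ z

  dom : Pred (Vec ℕ n) 0ℓ
  dom x = ∃[ y ] x ↦ y

infix 4 _≈_

-- Equality of partial functions; the functionality proofs are disregarded.
_≈_ : ∀ {n} → PFun n → PFun n → Set
q ≈ r = PFun._↦_ q ⇔ᵣ PFun._↦_ r

∅ : ∀ {n} → PFun n
∅ = record { _↦_ = λ _ _ → ⊥ ; functional = λ () }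

total : ∀ {n} → (Vec ℕ n → ℕ) → PFun n
total f = record
  { _↦_        = λ x y → f x ≡ y
  ; functional = λ p q → trans (sym p) q
  }

uncurryᴾ : ∀ {n} → (ℕ → PFun n) → PFun (suc n)
uncurryᴾ θ = record
  { _↦_        = λ { (i ∷ x) y → PFun._↦_ (θ i) x y }
  ; functional = λ { {i ∷ x} → PFun.functional (θ i) {x} }
  }

-- Cube a is {0,…,a-1}ⁿ.
Cube : ∀ {n} → ℕ → Pred (Vec ℕ n) 0ℓ
Cube a = All (_< a)

Rec : ∀ n → Pred (PFun n) 0ℓ
Rec n r = ∃[ f ] Computable f × r ≈ total f

Anf : Pred ℕ 0ℓ → ∀ n → Pred (PFun n) 0ℓ
Anf A n r = Empty (PFun.dom r) ⊎ (∃[ a ] a ∈ A × PFun.dom r ≐ Cube a)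

𝒮 : Pred ℕ 0ℓ → ∀ n → Pred (PFun n) 0ℓ
𝒮 A n = Rec n ∪ Anf A n

------------------------------------------------------------------------
-- Coding of tuples, graphs

record Pairing : Set where
  field
    bijection : (ℕ × ℕ) ↔ ℕ

  ⟨_,_⟩ : ℕ → ℕ → ℕ
  ⟨ x , y ⟩ = Inverse.to bijection (x , y)

  unpair : ℕ → ℕ × ℕ
  unpair = Inverse.from bijection

  field
    computable : Computable₂ ⟨_,_⟩
    x≤⟨x,y⟩    : ∀ x y → x ≤ ⟨ x , y ⟩
    y≤⟨x,y⟩    : ∀ x y → y ≤ ⟨ x , y ⟩

  tuple : ∀ {m} → Vec ℕ (suc m) → ℕ
  tuple (x ∷ [])     = x
  tuple (x ∷ y ∷ ys) = ⟨ x , tuple (y ∷ ys) ⟩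

module _ (P : Pairing) where
  open Pairing P

  graph : ∀ {m} → PFun (suc m) → Pred ℕ 0ℓ
  graph q z = ∃[ x ] ∃[ y ] PFun._↦_ q x y × z ≡ ⟨ tuple x , y ⟩

  extGraph : ∀ {m} → PFun (suc m) → Pred ℕ 0ℓ
  extGraph {m} q =
      (λ z → Σ[ x ∈ Vec ℕ (suc m) ] z ≡ ⟨ tuple x , 0 ⟩)
    ∪ (λ z → ∃[ x ] ∃[ y ] PFun._↦_ q x y × z ≡ ⟨ tuple x , suc y ⟩)

------------------------------------------------------------------------
-- Quasi-Gödel numberings

record IsNumbering {n} (X : Pred (PFun n) 0ℓ) (θ : ℕ → PFun n) : Set₁ where
  field
    into       : ∀ i → θ i ∈ X
    surjective : ∀ r → r ∈ X → ∃[ i ] θ i ≈ r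

record IsQuasiGödel (P : Pairing) (A : Pred ℕ 0ℓ) {m} (θ : ℕ → PFun (suc m))
       : Set₁ where
  field
    isNumbering : IsNumbering (𝒮 A (suc m)) θ
    qgn-I       : ∃[ g ] Computable₁ g × extGraph P (uncurryᴾ θ) ≐ Range g
    qgn-II      : ∀ k → Computable₂ k →
                  ∃[ v ] Computable₁ v ×
                    (∀ i r → r ∈ 𝒮 A (suc m) →
                     Range (k i) ≐ extGraph P r → r ≈ θ (v i))

-- The index set {i : θ_i ∈ X}.
CompletelyCE : ∀ {n} → (ℕ → PFun n) → Pred (PFun n) 0ℓ → Set
CompletelyCE θ X = CE (λ i → θ i ∈ X)

------------------------------------------------------------------------
-- The canonical numbering of Anf

record CubeEnumeration (n : ℕ) : Set where
  field
    bijection : ℕ ↔ Vec ℕ n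

  κ : ℕ → Vec ℕ n
  κ = Inverse.to bijection

  κ⁻¹ : Vec ℕ n → ℕ
  κ⁻¹ = Inverse.from bijection

  field
    computable : ∀ j → Computable₁ (λ c → lookup (κ c) j)
    initial    : ∀ a c → κ c ∈ Cube a ⇔ c < a ^ n

record SequenceCoding : Set where
  field
    bijection : List ℕ ↔ ℕ

  decode : ℕ → List ℕ
  decode = Inverse.from bijection

  lth : ℕ → ℕ
  lth a = length (decode a)

  -- Effectiveness: the partial function (a , j) ↦ (a)_j, defined for
  -- 1 ≤ j ≤ lth a, has a total computable extension.
  field
    lth-computable : Computable₁ lth
    entry          : ℕ → ℕ → ℕ
    computable     : Computable₂ entry
    entry-correct  : ∀ a (j : Fin (lth a)) →
                     entry a (suc (toℕ j)) ≡ lookupˡ (decode a) j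

module _ (P : Pairing) {n} (K : CubeEnumeration n) (S : SequenceCoding)
         (f : ℕ → ℕ) where
  open Pairing P
  open CubeEnumeration K
  open SequenceCoding S

  α̂ : ℕ → PFun n
  α̂ j = record
    { _↦_        = λ x y →
          (κ⁻¹ x < lth a ⊓ f b ^ n × y ≡ entry a (suc (κ⁻¹ x)))
        ⊎ (lth a ≤ κ⁻¹ x × κ⁻¹ x < f b ^ n × y ≡ 0)
    ; functional = λ
        { (inj₁ (_ , p)) (inj₁ (_ , q)) → trans p (sym q)
        ; (inj₁ (p , _)) (inj₂ (q , _)) →
            contradiction q (<⇒≱ (<-≤-trans p (m⊓n≤m (lth a) (f b ^ n))))
        ; (inj₂ (p , _)) (inj₁ (q , _)) →
            contradiction p (<⇒≱ (<-≤-trans q (m⊓n≤m (lth a) (f b ^ n))))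
        ; (inj₂ (_ , _ , p)) (inj₂ (_ , _ , q)) → trans p (sym q)
        }
    }
    where
    a = proj₁ (unpair j)
    b = proj₂ (unpair j)

  Fresh : (ℕ → PFun n) → ℕ → ℕ → Set
  Fresh α i j = ∀ k → k ≤ i → ¬ (α̂ j ≈ α k)

  -- The recursion equations of α; they determine it up to _≈_.
  record IsCanonical (α : ℕ → PFun n) : Set where
    field
      base : α 0 ≈ ∅
      step : ∀ i → ∃[ j ] α (suc i) ≈ α̂ j
                        × Fresh α i j
                        × (∀ j′ → j′ < j → ¬ Fresh α i j′)

{-# OPTIONS --safe #-}
-- θ itself serves as the universal object: H = {i : θ_i(i,0,…,0) = 0} is c.e., and its
-- complement is not, since otherwise H would be decidable and the total function vanishing
-- exactly where x₁ ∉ H would have an index i with i ∈ H iff i ∉ H.  Hence, for completely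
-- c.e. X, no uniformly semirecursive family of graphs can realise members of X for i ∉ H
-- and non-members for i ∈ H.  The family "q, extended to r once i enters H" shows that X is
-- closed upwards; the family "r, cut off at a large cube once i enters H" shows that every
-- total member of X has a finite part in X.  Then C = {i : α_i ∈ X} works.
--
-- Conversely α_i is, computably in i, a table along κ, so that α_c ⊆ θ_i is semirecursive.
module Submission where

open import Defs
open import Data.Empty using (⊥)
open import Axiom.ExcludedMiddle using (ExcludedMiddle)
open import Data.Fin.Base using (Fin; zero; suc; fromℕ<)
open import Data.Fin.Patterns using (0F; 1F; 2F; 3F)
open import Data.Fin.Properties using (toℕ-fromℕ<)
open import Data.List.Base using (length; applyUpTo; upTo) renaming (lookup to lookupˡ)
open import Data.List.Membership.Propositional.Properties using (∈-upTo⁺)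
open import Data.List.Properties using (length-applyUpTo; lookup-applyUpTo)
open import Data.Nat.Base
open import Data.Nat.Properties
open import Data.Nat.Induction using (<-wellFounded)
open import Data.Product.Base using (Σ-syntax; ∃-syntax; _×_; _,_; proj₁; proj₂)
open import Data.Product.Properties using (,-injective)
open import Data.Sum.Base as Sum using (_⊎_; inj₁; inj₂)
open import Data.Vec.Base using (Vec; []; _∷_; lookup; tabulate; tail; replicate)
open import Data.Vec.Properties using (lookup∘tabulate)
open import Function.Base using (_∘_; id; case_of_)
open import Function.Bundles using (_⇔_; mk⇔; module Equivalence; module Inverse)
open import Function.Properties.Equivalence using () renaming (sym to ⇔-sym; trans to ⇔-trans)
open import Induction.WellFounded using (Acc; acc)
open import Level using (0ℓ)
open import Relation.Binary.Core using (_⇒_)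
open import Relation.Binary.Definitions using (_Respects_; tri<; tri≈; tri>)
open import Relation.Binary.PropositionalEquality
open import Relation.Nullary
open import Relation.Nullary.Decidable using (decidable-stable; map′)
open import Relation.Unary using (Pred; _∈_; _⊆_; _≐_)

open Equivalence using (to; from)

private
  variable
    n m : ℕ
    f g : Vec ℕ n → ℕ
    P Q : Pred (Vec ℕ n) 0ℓ

-- Closure properties of computable functions

resp-≗ : f ≗ g → Computable f → Computable g
resp-≗ f≗g (c , c↓) = c , λ xs → subst (c [ xs ]↓_) (f≗g xs) (c↓ xs)

record Computable* (h : Vec ℕ n → Vec ℕ m) : Set where
  constructor mk*
  field component : ∀ j → Computable λ xs → lookup (h xs) j

open Computable*

compose : {h : Vec ℕ n → Vec ℕ m} → Computable f → Computable* h → Computable (f ∘ h)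
compose {h = h} (c , c↓) hᶜ = comp c (tabulate (proj₁ ∘ component hᶜ)) , λ xs →
  comp↓ {ys = h xs}
    (λ j → subst (_[ xs ]↓ lookup (h xs) j) (sym (lookup∘tabulate _ j)) (proj₂ (component hᶜ j) xs))
    (c↓ (h xs))

var : (j : Fin n) → Computable λ xs → lookup xs j
var j = proj j , λ _ → proj↓ j

idᶜ : Computable* {n} id
idᶜ = mk* var

infixr 5 _∷ᶜ_
infixr 9 _∘ᶜ_

[]ᶜ : Computable* {n} λ _ → []
[]ᶜ = mk* λ ()

_∷ᶜ_ : {h : Vec ℕ n → Vec ℕ m} → Computable f → Computable* h →
       Computable* λ xs → f xs ∷ h xs
fᶜ ∷ᶜ hᶜ = mk* λ { zero → fᶜ ; (suc j) → component hᶜ j }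

_∘ᶜ_ : ∀ {k} {h : Vec ℕ n → Vec ℕ m} {h′ : Vec ℕ k → Vec ℕ n} →
       Computable* h → Computable* h′ → Computable* (h ∘ h′)
hᶜ ∘ᶜ hᶜ′ = mk* λ j → compose (component hᶜ j) hᶜ′

tailᶜ : Computable* {suc n} tail
tailᶜ = mk* λ j → resp-≗ (λ { (_ ∷ _) → refl }) (var (suc j))

app₁ : ∀ {φ} → Computable₁ φ → Computable f → Computable λ xs → φ (f xs)
app₁ φᶜ fᶜ = compose φᶜ (fᶜ ∷ᶜ []ᶜ)

app₂ : ∀ {φ} → Computable₂ φ → Computable f → Computable g →
       Computable λ xs → φ (f xs) (g xs)
app₂ φᶜ fᶜ gᶜ = compose φᶜ (fᶜ ∷ᶜ gᶜ ∷ᶜ []ᶜ)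

computable₁ : ∀ {φ} → Computable (λ xs → φ (lookup xs 0F)) → Computable₁ φ
computable₁ = resp-≗ λ { (_ ∷ []) → refl }

computable₂ : ∀ {φ} → Computable (λ xs → φ (lookup xs 0F) (lookup xs 1F)) → Computable₂ φ
computable₂ = resp-≗ λ { (_ ∷ _ ∷ []) → refl }

sucᶠ : Computable f → Computable λ xs → suc (f xs)
sucᶠ = app₁ (sucᶜ , λ { (_ ∷ []) → suc↓ })

const : ∀ k → Computable {n} λ _ → k
const zero    = zeroᶜ , λ _ → zero↓
const (suc k) = sucᶠ (const k)

constᶜ : (ys : Vec ℕ m) → Computable* {n} λ _ → ys
constᶜ ys = mk* λ j → const (lookup ys j)

primrec : (Vec ℕ n → ℕ) → (Vec ℕ (suc (suc n)) → ℕ) → Vec ℕ (suc n) → ℕ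
primrec z s (zero  ∷ xs) = z xs
primrec z s (suc k ∷ xs) = s (k ∷ primrec z s (k ∷ xs) ∷ xs)

primrecᶠ : Computable f → Computable g → Computable (primrec f g)
primrecᶠ {f = f} {g = g} (c , c↓) (d , d↓) = prec c d , λ { (k ∷ xs) → rec k xs }
  where
  rec : ∀ k xs → prec c d [ k ∷ xs ]↓ primrec f g (k ∷ xs)
  rec zero    xs = prec₀ (c↓ xs)
  rec (suc k) xs = prec₊ (rec k xs) (d↓ _)

muᶠ : Computable f → (h : ∀ xs → ∃[ y ] f (y ∷ xs) ≡ 0 × (∀ k → k < y → f (k ∷ xs) ≢ 0)) →
      Computable (proj₁ ∘ h)
muᶠ {f = f} (c , c↓) h = mu c , λ xs → let (y , fy≡0 , fk≢0) = h xs in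
  mu↓ (subst (c [ y ∷ xs ]↓_) fy≡0 (c↓ _)) λ k k<y →
    -- `mu↓` wants every earlier value in the form `suc z`; a nonzero value is the successor of its
    -- predecessor.
    pred (f (k ∷ xs)) ,
    subst (c [ k ∷ xs ]↓_) (sym (suc-pred _ {{≢-nonZero (fk≢0 k k<y)}})) (c↓ _)

infixl 6 _+ᶠ_ _∸ᶠ_
infixl 7 _*ᶠ_
infixl 8 _^ᶠ_

_+ᶠ_ : Computable f → Computable g → Computable λ xs → f xs + g xs
_+ᶠ_ = app₂ (resp-≗ (λ { (x ∷ y ∷ []) → correct x y }) (primrecᶠ (var 0F) (sucᶠ (var 1F))))
  where
  correct : ∀ x y → primrec _ _ (x ∷ y ∷ []) ≡ x + y
  correct zero    y = refl
  correct (suc x) y = cong suc (correct x y)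

_*ᶠ_ : Computable f → Computable g → Computable λ xs → f xs * g xs
_*ᶠ_ = app₂ (resp-≗ (λ { (x ∷ y ∷ []) → correct x y }) (primrecᶠ (const 0) (var 2F +ᶠ var 1F)))
  where
  correct : ∀ x y → primrec _ _ (x ∷ y ∷ []) ≡ x * y
  correct zero    y = refl
  correct (suc x) y = cong (y +_) (correct x y)

_^ᶠ_ : Computable f → ∀ k → Computable λ xs → f xs ^ k
fᶜ ^ᶠ zero  = const 1
fᶜ ^ᶠ suc k = fᶜ *ᶠ fᶜ ^ᶠ k

predᶠ : Computable f → Computable λ xs → pred (f xs)
predᶠ = app₁ {φ = pred} (resp-≗ (λ { (zero ∷ []) → refl ; (suc _ ∷ []) → refl })
                     (primrecᶠ (const 0) (var 0F)))

_∸ᶠ_ : Computable f → Computable g → Computable λ xs → f xs ∸ g xs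
-- The recursion runs on the subtrahend and iterates `pred`, hence the swapped arguments.
fᶜ ∸ᶠ gᶜ = app₂ (resp-≗ (λ { (y ∷ x ∷ []) → correct y x }) (primrecᶠ (var 0F) (predᶠ (var 1F))))
                gᶜ fᶜ
  where
  correct : ∀ y x → primrec _ _ (y ∷ x ∷ []) ≡ x ∸ y
  correct zero    x = refl
  correct (suc y) x = trans (cong pred (correct y x)) (pred[m∸n]≡m∸[1+n] x y)

ifZero : ℕ → ℕ → ℕ → ℕ
ifZero zero    x y = x
ifZero (suc _) x y = y

ifZeroᶠ : ∀ {h : Vec ℕ n → ℕ} → Computable h → Computable f → Computable g →
          Computable λ xs → ifZero (h xs) (f xs) (g xs)
ifZeroᶠ {f = f} {g = g} {h = h} hᶜ fᶜ gᶜ = resp-≗ (λ xs → correct (h xs) (f xs) (g xs))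
  (compose (primrecᶠ (var 0F) (var 3F)) (hᶜ ∷ᶜ fᶜ ∷ᶜ gᶜ ∷ᶜ []ᶜ))
  where
  correct : ∀ c x y → primrec _ _ (c ∷ x ∷ y ∷ []) ≡ ifZero c x y
  correct zero    x y = refl
  correct (suc _) x y = refl

ifZero-≡ : ∀ {c x y} → c ≡ 0 → ifZero c x y ≡ x
ifZero-≡ refl = refl

ifZero-≢ : ∀ {c x y} → c ≢ 0 → ifZero c x y ≡ y
ifZero-≢ {zero}  c≢0 = contradiction refl c≢0
ifZero-≢ {suc _} _   = refl

sumᵇ : (Vec ℕ (suc n) → ℕ) → Vec ℕ (suc n) → ℕ
sumᵇ f = primrec (λ _ → 0) (λ v → lookup v 1F + f (lookup v 0F ∷ tail (tail v)))

sumᵇᶠ : Computable f → Computable (sumᵇ f)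
sumᵇᶠ fᶜ = primrecᶠ (const 0) (var 1F +ᶠ compose fᶜ (var 0F ∷ᶜ tailᶜ ∘ᶜ tailᶜ))

-- A sum of natural numbers vanishes only if every summand does, so one sum tests a bounded
-- universal statement.
sumᵇ≡0 : ∀ (f : Vec ℕ (suc n) → ℕ) b xs →
         sumᵇ f (b ∷ xs) ≡ 0 ⇔ (∀ y → y < b → f (y ∷ xs) ≡ 0)
sumᵇ≡0 f b xs = mk⇔ (λ eq y → fwd b eq y ∘ ≤⇒≤′) (bwd b)
  where
  fwd : ∀ b → sumᵇ f (b ∷ xs) ≡ 0 → ∀ y → y <′ b → f (y ∷ xs) ≡ 0
  fwd (suc b) eq y ≤′-refl       = m+n≡0⇒n≡0 (sumᵇ f (b ∷ xs)) eq
  fwd (suc b) eq y (≤′-step y<b) = fwd b (m+n≡0⇒m≡0 (sumᵇ f (b ∷ xs)) eq) y y<b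

  bwd : ∀ b → (∀ y → y < b → f (y ∷ xs) ≡ 0) → sumᵇ f (b ∷ xs) ≡ 0
  bwd zero    h = refl
  bwd (suc b) h = cong₂ _+_ (bwd b λ y y<b → h y (m<n⇒m<1+n y<b)) (h b (n<1+n b))

-- Recursive predicates

-- Truth is encoded by 0, the value that `mu` searches for. Conjunction then becomes addition and
-- disjunction multiplication.
record Recursive {n} (P : Pred (Vec ℕ n) 0ℓ) : Set where
  field
    char       : Vec ℕ n → ℕ
    char-computable : Computable char
    char-correct    : ∀ xs → P xs ⇔ char xs ≡ 0

  decide : ∀ xs → Dec (P xs)
  decide xs = map′ (from (char-correct xs)) (to (char-correct xs)) (char xs ≟ 0)

open Recursive

resp-⇔ʳ : (∀ xs → P xs ⇔ Q xs) → Recursive P → Recursive Q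
resp-⇔ʳ P⇔Q R = record
  { char = char R ; char-computable = char-computable R
  ; char-correct = λ xs → ⇔-trans (⇔-sym (P⇔Q xs)) (char-correct R xs) }

substʳ : {h : Vec ℕ n → Vec ℕ m} → Recursive P → Computable* h → Recursive (P ∘ h)
substʳ {h = h} R hᶜ = record
  { char = char R ∘ h
  ; char-computable = compose (char-computable R) hᶜ
  ; char-correct = char-correct R ∘ h }

infix  4 _≡ʳ_ _<ʳ_
infixr 2 _×ʳ_
infixr 3 ¬ʳ_

_<ʳ_ : Computable f → Computable g → Recursive λ xs → f xs < g xs
fᶜ <ʳ gᶜ = record
  { char-computable = sucᶠ fᶜ ∸ᶠ gᶜ ; char-correct = λ _ → mk⇔ m≤n⇒m∸n≡0 m∸n≡0⇒m≤n }

¬ʳ_ : Recursive P → Recursive λ xs → ¬ P xs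
¬ʳ R = record
  { char-computable = const 1 ∸ᶠ char-computable R
  ; char-correct = λ xs → mk⇔
      (λ ¬p → m≤n⇒m∸n≡0 (n≢0⇒n>0 (¬p ∘ from (char-correct R xs))))
      (λ eq p → contradiction (subst (λ c → 1 ∸ c ≡ 0) (to (char-correct R xs) p) eq) λ ()) }

_×ʳ_ : Recursive P → Recursive Q → Recursive λ xs → P xs × Q xs
R ×ʳ R′ = record
  { char-computable = char-computable R +ᶠ char-computable R′
  ; char-correct = λ xs → mk⇔
      (λ (p , q) → cong₂ _+_ (to (char-correct R xs) p) (to (char-correct R′ xs) q))
      (λ eq → from (char-correct R xs) (m+n≡0⇒m≡0 _ eq) ,
              from (char-correct R′ xs) (m+n≡0⇒n≡0 (char R xs) eq)) }

_⊎ʳ_ : Recursive P → Recursive Q → Recursive λ xs → P xs ⊎ Q xs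
R ⊎ʳ R′ = record
  { char-computable = char-computable R *ᶠ char-computable R′
  ; char-correct = λ xs → mk⇔
      (λ { (inj₁ p) → cong (_* char R′ xs) (to (char-correct R xs) p)
         ; (inj₂ q) → trans (cong (char R xs *_) (to (char-correct R′ xs) q))
                             (*-zeroʳ (char R xs)) })
      (Sum.map (from (char-correct R xs)) (from (char-correct R′ xs)) ∘ m*n≡0⇒m≡0∨n≡0 (char R xs)) }

_≡ʳ_ : Computable f → Computable g → Recursive λ xs → f xs ≡ g xs
fᶜ ≡ʳ gᶜ = resp-⇔ʳ
  (λ _ → mk⇔ (λ (f≮g , g≮f) → ≤-antisym (≮⇒≥ g≮f) (≮⇒≥ f≮g))
             (λ eq → <-irrefl eq , <-irrefl (sym eq)))
  (¬ʳ (fᶜ <ʳ gᶜ) ×ʳ ¬ʳ (gᶜ <ʳ fᶜ))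

∀<ʳ : Computable f → Recursive P → Recursive λ xs → ∀ y → y < f xs → P (y ∷ xs)
∀<ʳ {f = f} fᶜ R = record
  { char-computable = compose (sumᵇᶠ (char-computable R)) (fᶜ ∷ᶜ idᶜ)
  ; char-correct = λ xs → ⇔-trans
      (mk⇔ (λ h y y<f → to (char-correct R _) (h y y<f))
           (λ h y y<f → from (char-correct R _) (h y y<f)))
      (⇔-sym (sumᵇ≡0 (char R) (f xs) xs)) }

-- Obtained by duality from `∀<ʳ`; deciding the bounded search removes the double negation.
∃<ʳ : Computable f → Recursive P → Recursive λ xs → ∃[ y ] y < f xs × P (y ∷ xs)
∃<ʳ {f = f} fᶜ R = resp-⇔ʳ
  (λ xs → mk⇔
    (λ ¬∀¬ → decidable-stable (anyUpTo? (λ y → decide R (y ∷ xs)) (f xs))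
      λ ¬∃ → ¬∀¬ λ y y<f p → ¬∃ (y , y<f , p))
    (λ (y , y<f , p) ∀¬ → ∀¬ y y<f p))
  (¬ʳ ∀<ʳ fᶜ (¬ʳ R))

least : ∀ {P : Pred ℕ 0ℓ} → (∀ k → Dec (P k)) → ∃[ y ] P y →
        ∃[ y ] P y × (∀ k → k < y → ¬ P k)
least {P} P? (y , Py) = descend y (<-wellFounded y) Py
  where
  descend : ∀ y → Acc _<_ y → P y → ∃[ y ] P y × (∀ k → k < y → ¬ P k)
  descend y (acc rs) Py with anyUpTo? P? y
  ... | yes (k , k<y , Pk) = descend k (rs k<y) Pk
  ... | no ¬∃              = y , Py , λ k k<y Pk → ¬∃ (k , k<y , Pk)

-- Returning the least solution makes the result computable by `mu`; its minimality later identifies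
-- a search result with the next value of `code`.
module Search (R : Recursive P) (R-total : ∀ xs → ∃[ y ] P (y ∷ xs)) where

  private
    leastSolution : ∀ xs → ∃[ y ] P (y ∷ xs) × (∀ k → k < y → ¬ P (k ∷ xs))
    leastSolution xs = least (λ y → decide R (y ∷ xs)) (R-total xs)

  search : Vec ℕ _ → ℕ
  search xs = proj₁ (leastSolution xs)

  search-solves : ∀ xs → P (search xs ∷ xs)
  search-solves xs = proj₁ (proj₂ (leastSolution xs))

  search-least : ∀ xs k → k < search xs → ¬ P (k ∷ xs)
  search-least xs = proj₂ (proj₂ (leastSolution xs))

  search-computable : Computable search
  search-computable = muᶠ (char-computable R) λ xs → search xs ,
    to (char-correct R _) (search-solves xs) ,
    λ k k<y → search-least xs k k<y ∘ from (char-correct R _)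

-- Semirecursive predicates

-- The predicate is an increasing union of decidable stages. Monotonicity allows finitely many
-- confirmations to be moved to one common stage, their maximum.
record Semi {n} (P : Pred (Vec ℕ n) 0ℓ) : Set₁ where
  field
    Stage     : Pred (Vec ℕ (suc n)) 0ℓ
    recursive : Recursive Stage
    mono      : ∀ {xs s t} → s ≤ t → Stage (s ∷ xs) → Stage (t ∷ xs)
    exhausts  : ∀ xs → P xs ⇔ (∃[ t ] Stage (t ∷ xs))

open Semi

resp-⇔ : (∀ xs → P xs ⇔ Q xs) → Semi P → Semi Q
resp-⇔ P⇔Q S = record
  { recursive = recursive S ; mono = mono S
  ; exhausts = λ xs → ⇔-trans (⇔-sym (P⇔Q xs)) (exhausts S xs) }

substˢ : {h : Vec ℕ n → Vec ℕ m} → Semi P → Computable* h → Semi (P ∘ h)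
substˢ {h = h} S hᶜ = record
  { Stage = λ v → Stage S (lookup v 0F ∷ h (tail v))
  ; recursive = substʳ (recursive S) (var 0F ∷ᶜ hᶜ ∘ᶜ tailᶜ)
  ; mono = mono S
  ; exhausts = exhausts S ∘ h }

⌞_⌟ : Recursive P → Semi P
⌞ R ⌟ = record
  { recursive = substʳ R tailᶜ ; mono = λ _ p → p
  ; exhausts = λ _ → mk⇔ (0 ,_) proj₂ }

infixr 2 _×ˢ_
infixr 1 _⊎ˢ_

_×ˢ_ : Semi P → Semi Q → Semi λ xs → P xs × Q xs
S ×ˢ T = record
  { recursive = recursive S ×ʳ recursive T
  ; mono = λ s≤t (p , q) → mono S s≤t p , mono T s≤t q
  ; exhausts = λ xs → mk⇔
      (λ (p , q) → let (s , p′) = to (exhausts S xs) p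
                       (t , q′) = to (exhausts T xs) q
                   in s ⊔ t , mono S (m≤m⊔n s t) p′ , mono T (m≤n⊔m s t) q′)
      (λ (t , p , q) → from (exhausts S xs) (t , p) , from (exhausts T xs) (t , q)) }

_⊎ˢ_ : Semi P → Semi Q → Semi λ xs → P xs ⊎ Q xs
S ⊎ˢ T = record
  { recursive = recursive S ⊎ʳ recursive T
  ; mono = λ s≤t → Sum.map (mono S s≤t) (mono T s≤t)
  ; exhausts = λ xs → mk⇔
      (λ { (inj₁ p) → let (t , p′) = to (exhausts S xs) p in t , inj₁ p′
         ; (inj₂ q) → let (t , q′) = to (exhausts T xs) q in t , inj₂ q′ })
      (λ { (t , inj₁ p) → inj₁ (from (exhausts S xs) (t , p))
         ; (t , inj₂ q) → inj₂ (from (exhausts T xs) (t , q)) }) }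

swapᶜ : Computable* {suc (suc n)} λ v → lookup v 1F ∷ lookup v 0F ∷ tail (tail v)
swapᶜ = var 1F ∷ᶜ var 0F ∷ᶜ tailᶜ ∘ᶜ tailᶜ

∃ˢ : Semi P → Semi λ xs → ∃[ y ] P (y ∷ xs)
∃ˢ S = record
  -- A single number bounds the witness and also serves as its stage, which dovetails the two
  -- searches.
  { Stage = λ v → ∃[ y ] y < lookup v 0F × Stage S (lookup v 0F ∷ y ∷ tail v)
  ; recursive = ∃<ʳ (var 0F) (substʳ (recursive S) swapᶜ)
  ; mono = λ s≤t (y , y<s , p) → y , <-≤-trans y<s s≤t , mono S s≤t p
  ; exhausts = λ xs → mk⇔
      (λ (y , p) → let (t , p′) = to (exhausts S (y ∷ xs)) p
                   in suc y ⊔ t , y , m≤m⊔n (suc y) t , mono S (m≤n⊔m (suc y) t) p′)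
      (λ (t , y , _ , p) → y , from (exhausts S (y ∷ xs)) (t , p)) }

∀<ˢ : Computable f → Semi P → Semi λ xs → ∀ y → y < f xs → P (y ∷ xs)
∀<ˢ {f = f} {P = P} fᶜ S = record
  { Stage = λ v → ∀ y → y < f (tail v) → Stage S (lookup v 0F ∷ y ∷ tail v)
  ; recursive = ∀<ʳ (compose fᶜ tailᶜ) (substʳ (recursive S) swapᶜ)
  ; mono = λ s≤t h y y<f → mono S s≤t (h y y<f)
  ; exhausts = λ xs → mk⇔
      (λ h → collect (f xs) λ y y<f → to (exhausts S (y ∷ xs)) (h y y<f))
      (λ (t , h) y y<f → from (exhausts S (y ∷ xs)) (t , h y y<f)) }
  where
  -- Finitely many confirmations have a common stage, by induction on their number.
  collect : ∀ {xs} b → (∀ y → y < b → ∃[ t ] Stage S (t ∷ y ∷ xs)) →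
            ∃[ t ] (∀ y → y < b → Stage S (t ∷ y ∷ xs))
  collect zero    h = 0 , λ _ ()
  collect (suc b) h =
    let (s , h′) = collect b λ y y<b → h y (m<n⇒m<1+n y<b)
        (t , p)  = h b (n<1+n b)
    in s ⊔ t , λ y y<1+b → case m≤n⇒m<n∨m≡n (≤-pred y<1+b) of λ
      { (inj₁ y<b)  → mono S (m≤m⊔n s t) (h′ y y<b)
      ; (inj₂ refl) → mono S (m≤n⊔m s t) p }

-- Both sides are run until one confirms. By disjointness, `P` holds exactly when `S` has confirmed
-- at the stage found.
post-theorem : Semi P → Semi Q → (∀ xs → P xs ⊎ Q xs) → (∀ xs → P xs → ¬ Q xs) → Recursive P
post-theorem {P = P} S T P⊎Q P∩Q = resp-⇔ʳ
  (λ xs → mk⇔ (λ p → from (exhausts S xs) (search xs , p))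
              (λ p → case search-solves xs of λ
                { (inj₁ p′) → p′
                ; (inj₂ q)  → contradiction (from (exhausts T xs) (search xs , q)) (P∩Q xs p) }))
  (substʳ (recursive S) (search-computable ∷ᶜ idᶜ))
  where
  solvable : ∀ xs → ∃[ t ] (Stage S (t ∷ xs) ⊎ Stage T (t ∷ xs))
  solvable xs with P⊎Q xs
  ... | inj₁ p = let (t , p′) = to (exhausts S xs) p in t , inj₁ p′
  ... | inj₂ q = let (t , q′) = to (exhausts T xs) q in t , inj₂ q′

  open Search (recursive S ⊎ʳ recursive T) solvable

-- Partial functions

infix 4 _∋_↦_

_∋_↦_ : PFun n → Vec ℕ n → ℕ → Set
q ∋ x ↦ y = PFun._↦_ q x y

infix 4 _⊑_

_⊑_ : PFun n → PFun n → Set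
q ⊑ r = PFun._↦_ q ⇒ PFun._↦_ r

≈-sym : (q r : PFun n) → q ≈ r → r ≈ q
≈-sym _ _ (q⊑r , r⊑q) = r⊑q , q⊑r

≈-trans : (q r s : PFun n) → q ≈ r → r ≈ s → q ≈ s
≈-trans _ _ _ (q⊑r , r⊑q) (r⊑s , s⊑r) = r⊑s ∘ q⊑r , r⊑q ∘ s⊑r

-- Pairs and tuples

module Tuples (pairing : Pairing) where
  open Pairing pairing renaming (computable to pair-computable) hiding (bijection)
  open Inverse (Pairing.bijection pairing) using (strictlyInverseˡ; strictlyInverseʳ)

  ⟨⟩-injective : ∀ {x y x′ y′} → ⟨ x , y ⟩ ≡ ⟨ x′ , y′ ⟩ → x ≡ x′ × y ≡ y′
  ⟨⟩-injective eq = ,-injective (trans (sym (strictlyInverseʳ _))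
                                       (trans (cong unpair eq) (strictlyInverseʳ _)))

  fst snd : ℕ → ℕ
  fst = proj₁ ∘ unpair
  snd = proj₂ ∘ unpair

  ⟨fst,snd⟩ : ∀ z → ⟨ fst z , snd z ⟩ ≡ z
  ⟨fst,snd⟩ = strictlyInverseˡ

  fst-⟨⟩ : ∀ x y → fst ⟨ x , y ⟩ ≡ x
  fst-⟨⟩ x y = cong proj₁ (strictlyInverseʳ (x , y))

  snd-⟨⟩ : ∀ x y → snd ⟨ x , y ⟩ ≡ y
  snd-⟨⟩ x y = cong proj₂ (strictlyInverseʳ (x , y))

  pairᶠ : Computable f → Computable g → Computable λ xs → ⟨ f xs , g xs ⟩
  pairᶠ = app₂ pair-computable

  -- The inverse of the pairing is recovered by search: since the second component is at most `z`,
  -- it can be quantified boundedly while the first is sought.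
  fstᶠ : Computable f → Computable λ xs → fst (f xs)
  fstᶠ = app₁ (resp-≗ (λ { (z ∷ []) →
      let (_ , _ , eq) = search-solves (z ∷ [])
      in trans (sym (fst-⟨⟩ _ _)) (cong fst eq) }) search-computable)
    where
    solvable : (xs : Vec ℕ 1) →
               ∃[ x ] ∃[ y ] y < suc (lookup xs 0F) × ⟨ x , y ⟩ ≡ lookup xs 0F
    solvable (z ∷ []) = fst z , snd z ,
      s≤s (subst (snd z ≤_) (⟨fst,snd⟩ z) (y≤⟨x,y⟩ (fst z) (snd z))) , ⟨fst,snd⟩ z

    open Search (∃<ʳ (sucᶠ (var 1F)) (pairᶠ (var 1F) (var 0F) ≡ʳ var 2F)) solvable

  sndᶠ : Computable f → Computable λ xs → snd (f xs)
  sndᶠ = app₁ (resp-≗ (λ { (z ∷ []) →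
      trans (sym (snd-⟨⟩ _ _)) (cong snd (search-solves (z ∷ []))) }) search-computable)
    where
    -- With the first component known, the second is the solution of a decidable equation.
    open Search (pairᶠ (fstᶠ (var 1F)) (var 0F) ≡ʳ var 1F)
                (λ xs → snd (lookup xs 0F) , ⟨fst,snd⟩ (lookup xs 0F))

  tuple-computable : Computable (tuple {m})
  tuple-computable {zero}  = resp-≗ (λ { (_ ∷ []) → refl }) (var 0F)
  tuple-computable {suc m} = resp-≗ (λ { (_ ∷ _ ∷ _) → refl })
                                    (pairᶠ (var 0F) (compose tuple-computable tailᶜ))

  tuple-injective : (x x′ : Vec ℕ (suc m)) → tuple x ≡ tuple x′ → x ≡ x′
  tuple-injective (_ ∷ [])      (_ ∷ [])      eq = cong (_∷ []) eq
  tuple-injective (_ ∷ _ ∷ _)   (_ ∷ _ ∷ _)   eq =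
    let (eq₁ , eq₂) = ⟨⟩-injective eq in cong₂ _∷_ eq₁ (tuple-injective _ _ eq₂)

  graph-⊆⁻ : (q r : PFun (suc m)) → graph pairing q ⊆ graph pairing r → q ⊑ r
  graph-⊆⁻ q r sub {x} {y} qxy with sub (x , y , qxy , refl)
  ... | x′ , y′ , rx′y′ , eq =
    let (eq₁ , eq₂) = ⟨⟩-injective eq
    in subst₂ (r ∋_↦_) (sym (tuple-injective x x′ eq₁)) (sym eq₂) rx′y′

  graph-⊆⁺ : (q r : PFun (suc m)) → q ⊑ r → graph pairing q ⊆ graph pairing r
  graph-⊆⁺ q r q⊑r (x , y , qxy , eq) = x , y , q⊑r qxy , eq

-- Enumerable sets

CE⇒Semi : ∀ {C} → CE C → Semi {1} λ xs → C (lookup xs 0F)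
CE⇒Semi (inj₁ empty) =
  -- The empty set is presented by the decidable predicate `x < x`.
  resp-⇔ (λ _ → mk⇔ (λ lt → contradiction lt (<-irrefl refl)) (λ c → contradiction c (empty _)))
         ⌞ var 0F <ʳ var 0F ⌟
CE⇒Semi (inj₂ (f , fᶜ , C⊆f , f⊆C)) =
  resp-⇔ (λ _ → mk⇔ f⊆C C⊆f) (∃ˢ ⌞ app₁ fᶜ (var 0F) ≡ʳ var 1F ⌟)

-- Excluded middle selects the clause of `CE`. For nonempty `C`, a number coding `x` and `t` yields
-- `x` if `x` is confirmed by stage `t`, and the fixed member `x₀` otherwise.
Semi⇒CE : ExcludedMiddle 0ℓ → Pairing → ∀ {C} → Semi {1} (λ xs → C (lookup xs 0F)) → CE C
Semi⇒CE em pairing {C} S with em {∃[ x ] C x}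
... | no ¬∃        = inj₁ λ x Cx → ¬∃ (x , Cx)
... | yes (x₀ , Cx₀) = inj₂ (enum , computable₁ enumᶜ , sub , sup)
  where
  open Pairing pairing using (⟨_,_⟩)
  open Tuples pairing

  stage : ℕ → ℕ → ℕ
  stage t x = char (recursive S) (t ∷ x ∷ [])

  enum : ℕ → ℕ
  enum z = ifZero (stage (snd z) (fst z)) (fst z) x₀

  enumᶜ : Computable λ xs → enum (lookup xs 0F)
  enumᶜ = ifZeroᶠ (compose (char-computable (recursive S))
                           (sndᶠ (var 0F) ∷ᶜ fstᶠ (var 0F) ∷ᶜ []ᶜ))
                  (fstᶠ (var 0F)) (const x₀)

  sub : C ⊆ Range enum
  sub {x} Cx =
    let (t , Sxt) = to (exhausts S (x ∷ [])) Cx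
    in ⟨ x , t ⟩ , trans
         (cong₂ (λ a b → ifZero (stage b a) a x₀) (fst-⟨⟩ x t) (snd-⟨⟩ x t))
         (ifZero-≡ (to (char-correct (recursive S) _) Sxt))

  sup : Range enum ⊆ C
  sup (z , refl) with stage (snd z) (fst z) in eq
  ... | zero  = from (exhausts S (fst z ∷ [])) (snd z , from (char-correct (recursive S) _) eq)
  ... | suc _ = Cx₀

-- Finite functions as tables along the enumeration κ

module Tables {m} (K : CubeEnumeration (suc m)) where
  open CubeEnumeration K renaming (computable to κ-computable) hiding (bijection)
  open Inverse (CubeEnumeration.bijection K) using ()
    renaming (strictlyInverseˡ to κ-κ⁻¹; strictlyInverseʳ to κ⁻¹-κ) public

  κᶜ : Computable f → Computable* λ xs → κ (f xs)
  κᶜ fᶜ = mk* λ j → app₁ (κ-computable j) fᶜ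

  -- Inclusion and equality of finite functions become bounded statements about positions along `κ`.
  -- The values of `v` from `N` on carry no information.
  record Table (N : ℕ) (v : ℕ → ℕ) (q : PFun (suc m)) : Set where
    constructor table
    field entries : ∀ x y → q ∋ x ↦ y ⇔ (κ⁻¹ x < N × y ≡ v (κ⁻¹ x))

  open Table public

  module _ {N : ℕ} {v : ℕ → ℕ} {q : PFun (suc m)} (tab : Table N v q) where

    table-κ : ∀ p y → q ∋ κ p ↦ y ⇔ (p < N × y ≡ v p)
    table-κ p y = subst (λ p′ → q ∋ κ p ↦ y ⇔ (p′ < N × y ≡ v p′)) (κ⁻¹-κ p) (entries tab (κ p) y)

    table-⊑ : ∀ r → q ⊑ r ⇔ (∀ p → p < N → r ∋ κ p ↦ v p)
    table-⊑ r = mk⇔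
      (λ q⊑r p p<N → q⊑r (from (table-κ p (v p)) (p<N , refl)))
      (λ h {x} {y} qxy → let (p<N , y≡v) = to (entries tab x y) qxy
                         in subst₂ (r ∋_↦_) (κ-κ⁻¹ x) (sym y≡v) (h (κ⁻¹ x) p<N))

  -- Otherwise `κ N′` would lie in the domain of `q` but not in that of `r`.
  table-size-≤ : ∀ {N v q N′ v′ r} → Table N v q → Table N′ v′ r →
                     q ⊑ r → N ≤ N′
  table-size-≤ {N} {v} {N′ = N′} tab tab′ q⊑r = ≮⇒≥ λ N′<N →
    <-irrefl refl (proj₁ (to (table-κ tab′ N′ (v N′))
                             (q⊑r (from (table-κ tab N′ (v N′)) (N′<N , refl)))))

  table-≈ : ∀ {N v q N′ v′ r} → Table N v q → Table N′ v′ r →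
                q ≈ r ⇔ (N ≡ N′ × (∀ p → p < N → v p ≡ v′ p))
  table-≈ {v = v} {v′ = v′} {r = r} tab tab′ = mk⇔
    (λ (q⊑r , r⊑q) →
      ≤-antisym (table-size-≤ tab tab′ q⊑r) (table-size-≤ tab′ tab r⊑q) ,
      λ p p<N → proj₂ (to (table-κ tab′ p (v p)) (to (table-⊑ tab r) q⊑r p p<N)))
    (λ { (refl , v≡v′) →
      (λ {x} {y} qxy → let (lt , eq) = to (entries tab x y) qxy
                       in from (entries tab′ x y) (lt , trans eq (v≡v′ _ lt))) ,
      (λ {x} {y} rxy → let (lt , eq) = to (entries tab′ x y) rxy
                       in from (entries tab x y) (lt , trans eq (sym (v≡v′ _ lt)))) })

  Cube⇔κ⁻¹< : ∀ a x → x ∈ Cube a ⇔ κ⁻¹ x < a ^ suc m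
  Cube⇔κ⁻¹< a x = subst (λ x′ → x′ ∈ Cube a ⇔ κ⁻¹ x < a ^ suc m) (κ-κ⁻¹ x) (initial a (κ⁻¹ x))

-- The canonical numbering

module Canonical (em : ExcludedMiddle 0ℓ) (pairing : Pairing) (S : SequenceCoding)
                 {m} (K : CubeEnumeration (suc m))
                 {φ : ℕ → ℕ} (φᶜ : Computable₁ φ)
                 {α : ℕ → PFun (suc m)} (can : IsCanonical pairing K S φ α) where
  open Pairing pairing using (⟨_,_⟩)
  open CubeEnumeration K using (κ; κ⁻¹)
  open SequenceCoding S renaming (computable to entry-computable) hiding (bijection)
  open IsCanonical can
  open Tuples pairing
  open Tables K

  size^ : ℕ → ℕ
  size^ j = φ (snd j) ^ suc m

  -- The truncated difference vanishes exactly for `p < lth (fst j)`, so this merges the two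
  -- defining clauses of `α̂`: entries first, then padding by 0.
  value^ : ℕ → ℕ → ℕ
  value^ j p = ifZero (suc p ∸ lth (fst j)) (entry (fst j) (suc p)) 0

  size^ᶠ : Computable f → Computable λ xs → size^ (f xs)
  size^ᶠ fᶜ = app₁ φᶜ (sndᶠ fᶜ) ^ᶠ suc m

  value^ᶠ : Computable f → Computable g → Computable λ xs → value^ (f xs) (g xs)
  value^ᶠ fᶜ gᶜ = ifZeroᶠ (sucᶠ gᶜ ∸ᶠ app₁ lth-computable (fstᶠ fᶜ))
                          (app₂ entry-computable (fstᶠ fᶜ) (sucᶠ gᶜ)) (const 0)

  α̂′ : ℕ → PFun (suc m)
  α̂′ = α̂ pairing K S φ

  value^-entry : ∀ j p → p < lth (fst j) → value^ j p ≡ entry (fst j) (suc p)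
  value^-entry j p p<lth = ifZero-≡ (m≤n⇒m∸n≡0 p<lth)

  value^-pad : ∀ j p → lth (fst j) ≤ p → value^ j p ≡ 0
  value^-pad j p lth≤p = ifZero-≢ (m>n⇒m∸n≢0 (s≤s lth≤p))

  α̂-table : ∀ j → Table (size^ j) (value^ j) (α̂′ j)
  α̂-table j = table λ x y → mk⇔
    (λ { (inj₁ (lt , eq)) → m<n⊓o⇒m<o (lth (fst j)) _ lt ,
           trans eq (sym (value^-entry j _ (m<n⊓o⇒m<n (lth (fst j)) _ lt)))
       ; (inj₂ (ge , lt , eq)) → lt , trans eq (sym (value^-pad j _ ge)) })
    (λ (lt , eq) → case κ⁻¹ x <? lth (fst j) of λ
      { (yes <lth) → inj₁ (⊓-pres-m< <lth lt , trans eq (value^-entry j _ <lth))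
      ; (no ≮lth)  → inj₂ (≮⇒≥ ≮lth , lt , trans eq (value^-pad j _ (≮⇒≥ ≮lth))) })

  ∅-table : ∀ {q} → q ≈ ∅ → ∀ v → Table 0 v q
  ∅-table (q⊑∅ , _) v = table λ x y → mk⇔ (λ qxy → contradiction qxy q⊑∅) (λ { (() , _) })

  code : ℕ → ℕ
  code i = proj₁ (step i)

  α-suc : ∀ i → α (suc i) ≈ α̂′ (code i)
  α-suc i = proj₁ (proj₂ (step i))

  Fresh′ : ℕ → ℕ → Set
  Fresh′ = Fresh pairing K S φ α

  code-fresh : ∀ i → Fresh′ i (code i)
  code-fresh i = proj₁ (proj₂ (proj₂ (step i)))

  code-least : ∀ i j → j < code i → ¬ Fresh′ i j
  code-least i = proj₂ (proj₂ (proj₂ (step i)))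

  ¬fresh⇒ : ∀ i j → ¬ Fresh′ i j → ∃[ k ] k ≤ i × α̂′ j ≈ α k
  ¬fresh⇒ i j ¬fresh = decidable-stable em λ ¬∃ → ¬fresh λ k k≤i eq → ¬∃ (k , k≤i , eq)

  -- If the codes were equal, `α̂′ (code (suc i))` would already be `α (suc i)`. If the later one
  -- were smaller, it would be fresh at `i` too, against the leastness of `code i`.
  code-mono : ∀ i → code i < code (suc i)
  code-mono i with <-cmp (code i) (code (suc i))
  ... | tri< lt _ _ = lt
  ... | tri≈ _ eq _ = contradiction
    (subst (λ j → α̂′ j ≈ α (suc i)) eq (≈-sym (α (suc i)) (α̂′ (code i)) (α-suc i)))
    (code-fresh (suc i) (suc i) ≤-refl)
  ... | tri> _ _ gt = contradiction
    (λ k k≤i → code-fresh (suc i) k (m≤n⇒m≤1+n k≤i))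
    (code-least i _ gt)

  ≤-code : ∀ i → i ≤ code i
  ≤-code zero    = z≤n
  ≤-code (suc i) = ≤-<-trans (≤-code i) (code-mono i)

  -- Strict growth of `code` gives `j < code (suc j)`, so `j` was passed over and its function is
  -- already listed.
  α-covers-α̂ : ∀ j → ∃[ k ] α̂′ j ≈ α k
  α-covers-α̂ j =
    let (k , _ , eq) = ¬fresh⇒ (suc j) j (code-least (suc j) j (≤-code (suc j))) in k , eq

  code-monoʳ : ∀ {i k} → i < k → code i < code k
  code-monoʳ {i} {suc k} i<1+k = case m≤n⇒m<n∨m≡n (≤-pred i<1+k) of λ
    { (inj₁ i<k)  → <-trans (code-monoʳ i<k) (code-mono k)
    ; (inj₂ refl) → code-mono k }

  Same : ℕ → ℕ → Set
  Same j j′ = size^ j ≡ size^ j′ × (∀ p → p < size^ j → value^ j p ≡ value^ j′ p)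

  same⇔≈ : ∀ j j′ → α̂′ j ≈ α̂′ j′ ⇔ Same j j′
  same⇔≈ j j′ = table-≈ (α̂-table j) (α̂-table j′)

  -- Unlike freshness, New does not mention α; the least fresh j after code i turns out to
  -- be the least j > code i with New j, which makes code computable.
  New : ℕ → Set
  New j = size^ j ≢ 0 × (∀ j′ → j′ < j → ¬ Same j j′)

  newʳ : Recursive {1} λ xs → New (lookup xs 0F)
  newʳ = ¬ʳ (size^ᶠ (var 0F) ≡ʳ const 0)
      ×ʳ ∀<ʳ (var 0F) (¬ʳ (size^ᶠ (var 1F) ≡ʳ size^ᶠ (var 0F)
                        ×ʳ ∀<ʳ (size^ᶠ (var 1F))
                               (value^ᶠ (var 2F) (var 0F) ≡ʳ value^ᶠ (var 1F) (var 0F))))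

  size≡0⇒≈∅ : ∀ j → size^ j ≡ 0 ⇔ α̂′ j ≈ α 0
  size≡0⇒≈∅ j = ⇔-sym (⇔-trans (table-≈ (α̂-table j) (∅-table {α 0} base (value^ j)))
                               (mk⇔ proj₁ (λ eq → eq , λ _ _ → refl)))

  -- A smaller index with the same table was passed over by leastness, so its function was listed by
  -- step `i`; this contradicts the freshness of `code i`.
  code-new : ∀ i → New (code i)
  code-new i =
    (λ size≡0 → code-fresh i 0 z≤n (to (size≡0⇒≈∅ (code i)) size≡0)) ,
    λ j j<code same → case ¬fresh⇒ i j (code-least i j j<code) of λ
      (k , k≤i , eq) → code-fresh i k k≤i
        (≈-trans (α̂′ (code i)) (α̂′ j) (α k) (from (same⇔≈ (code i) j) same) eq)

  -- An index passed over is not fresh: its function is empty, or equals some `α (suc k)` whose code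
  -- is at most `code i` and hence smaller than `j`.
  new-gap : ∀ i j → code i < j → j < code (suc i) → ¬ New j
  new-gap i j code<j j<code (size≢0 , new) with ¬fresh⇒ (suc i) j (code-least (suc i) j j<code)
  ... | zero  , _ , eq = size≢0 (from (size≡0⇒≈∅ j) eq)
  ... | suc k , s≤s k≤i , eq = new (code k) (≤-<-trans code-k≤code-i code<j)
    (to (same⇔≈ j (code k)) (≈-trans (α̂′ j) (α (suc k)) (α̂′ (code k)) eq (α-suc k)))
    where
    code-k≤code-i : code k ≤ code i
    code-k≤code-i = case m≤n⇒m<n∨m≡n k≤i of λ
      { (inj₁ k<i) → <⇒≤ (code-monoʳ k<i) ; (inj₂ refl) → ≤-refl }

  codeᶠ : Computable f → Computable λ xs → code (f xs)
  codeᶠ = app₁ (resp-≗ (λ { (i ∷ []) → correct i })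
    -- The starting value is a constant of the program; each later code is searched for above the
    -- previous one.
    (primrecᶠ (const (code 0)) (compose search-computable (var 1F ∷ᶜ []ᶜ))))
    where
    open Search {P = λ v → lookup v 1F < lookup v 0F × New (lookup v 0F)}
      ((var 1F <ʳ var 0F) ×ʳ substʳ newʳ (var 0F ∷ᶜ []ᶜ))
      -- The search must succeed above every number `x`, not only above codes; `code (suc x)`
      -- exceeds `x` by `≤-code`.
      (λ xs → code (suc (lookup xs 0F)) , ≤-code _ , code-new _)

    search-code : ∀ i → search (code i ∷ []) ≡ code (suc i)
    search-code i = ≤-antisym
      (≮⇒≥ λ lt → search-least (code i ∷ []) _ lt (code-mono i , code-new (suc i)))
      (≮⇒≥ λ lt → let (gt , new) = search-solves (code i ∷ []) in new-gap i _ gt lt new)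

    correct : ∀ i → primrec _ _ (i ∷ []) ≡ code i
    correct zero    = refl
    correct (suc i) = trans (cong (λ j → search (j ∷ [])) (correct i)) (search-code i)

  size : ℕ → ℕ
  size i = ifZero i 0 (size^ (code (pred i)))

  value : ℕ → ℕ → ℕ
  value i = value^ (code (pred i))

  sizeᶠ : Computable f → Computable λ xs → size (f xs)
  sizeᶠ fᶜ = ifZeroᶠ fᶜ (const 0) (size^ᶠ (codeᶠ (predᶠ fᶜ)))

  valueᶠ : Computable f → Computable g → Computable λ xs → value (f xs) (g xs)
  valueᶠ fᶜ = value^ᶠ (codeᶠ (predᶠ fᶜ))

  α-table : ∀ i → Table (size i) (value i) (α i)
  α-table zero      = ∅-table base (value 0)
  α-table (suc i) = table λ x y →
    ⇔-trans (mk⇔ (proj₁ (α-suc i)) (proj₂ (α-suc i))) (entries (α̂-table (code i)) x y)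

  module _ {A : Pred ℕ 0ℓ} (A≐Range : A ≐ Range φ) where

    α∈Anf : ∀ i → α i ∈ Anf A (suc m)
    α∈Anf zero    = inj₁ λ x (y , αxy) → proj₁ base αxy
    α∈Anf (suc i) = inj₂ (φ b , proj₂ A≐Range (b , refl) ,
        (λ {x} (y , αxy) → from (Cube⇔κ⁻¹< (φ b) x)
                                (proj₁ (to (entries (α-table (suc i)) x y) αxy))) ,
        (λ {x} x∈ → value (suc i) (κ⁻¹ x) ,
          from (entries (α-table (suc i)) x _) (to (Cube⇔κ⁻¹< (φ b) x) x∈ , refl)))
      where b = snd (code i)

    -- For a nonempty clause the values of `r` along `κ` are written into a sequence of length
    -- exactly `N`, so the index `j` built from it gives `r` without padding.
    Anf⊆α : ∀ r → r ∈ Anf A (suc m) → ∃[ k ] α k ≈ r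
    Anf⊆α r (inj₁ empty) = 0 , (λ αxy → contradiction αxy (proj₁ base)) ,
                               (λ {x} {y} rxy → contradiction (y , rxy) (empty x))
    Anf⊆α r (inj₂ (a , a∈A , dom⊆Cube , Cube⊆dom)) with proj₁ A≐Range a∈A
    ... | b , refl = let (k , eq) = α-covers-α̂ j in k , ≈-sym r (α k)
                       (≈-trans r (α̂′ j) (α k) r≈α̂ eq)
      where
      N = φ b ^ suc m

      defined : ∀ p → p < N → ∃[ y ] r ∋ κ p ↦ y
      defined p p<N = Cube⊆dom (from (CubeEnumeration.initial K (φ b) p) p<N)

      w : ℕ → ℕ
      w p with p <? N
      ... | yes p<N = proj₁ (defined p p<N)
      -- A default that makes `w` total; only positions below `N` enter the table.
      ... | no _    = 0

      r∋w : ∀ p → p < N → r ∋ κ p ↦ w p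
      r∋w p p<N with p <? N
      ... | yes p<N′ = proj₂ (defined p p<N′)
      ... | no p≮N   = contradiction p<N p≮N

      w-table : Table N w r
      w-table = table λ x y → mk⇔
        (λ rxy → let lt = to (Cube⇔κ⁻¹< (φ b) x) (dom⊆Cube (y , rxy))
                 in lt , PFun.functional r rxy
                      (subst (λ x′ → r ∋ x′ ↦ w (κ⁻¹ x)) (κ-κ⁻¹ x) (r∋w (κ⁻¹ x) lt)))
        (λ (lt , eq) → subst₂ (r ∋_↦_) (κ-κ⁻¹ x) (sym eq) (r∋w (κ⁻¹ x) lt))

      l = applyUpTo w N
      c = Inverse.to (SequenceCoding.bijection S) l
      j = ⟨ c , b ⟩

      decode-fst : decode (fst j) ≡ l
      decode-fst = trans (cong decode (fst-⟨⟩ c b))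
                         (Inverse.strictlyInverseʳ (SequenceCoding.bijection S) l)

      lookup-l : ∀ {l′ p} → l′ ≡ l → (p< : p < length l′) → lookupˡ l′ (fromℕ< p<) ≡ w p
      lookup-l refl p< = trans (lookup-applyUpTo w N (fromℕ< p<)) (cong w (toℕ-fromℕ< p<))

      entry-l : ∀ p → (p< : p < lth (fst j)) → entry (fst j) (suc p) ≡ w p
      entry-l p p< = trans (cong (entry (fst j) ∘ suc) (sym (toℕ-fromℕ< p<)))
                           (trans (entry-correct (fst j) (fromℕ< p<)) (lookup-l decode-fst p<))

      lth≡N : lth (fst j) ≡ N
      lth≡N = trans (cong length decode-fst) (length-applyUpTo w N)

      r≈α̂ : r ≈ α̂′ j
      r≈α̂ = from (table-≈ w-table (α̂-table j))
        (cong (λ b → φ b ^ suc m) (sym (snd-⟨⟩ c b)) , λ p p<N →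
         let p< = subst (p <_) (sym lth≡N) p<N
         in sym (trans (value^-entry j p p<) (entry-l p p<)))

-- Quasi-Gödel numberings

module QuasiGödel (em : ExcludedMiddle 0ℓ) (pairing : Pairing)
                  {m} (K : CubeEnumeration (suc m)) {A : Pred ℕ 0ℓ}
                  {θ : ℕ → PFun (suc m)} (qgn : IsQuasiGödel pairing A θ) where
  open Pairing pairing using (⟨_,_⟩; tuple)
  open CubeEnumeration K using (κ; κ⁻¹)
  open IsQuasiGödel qgn
  open IsNumbering isNumbering
  open Tuples pairing
  open Tables K

  𝒮′ : Pred (PFun (suc m)) 0ℓ
  𝒮′ = 𝒮 A (suc m)

  -- By QGN I a value `y` is confirmed once the enumeration lists the matching pair with second
  -- component `suc y`.
  evaluationˢ : {h : Vec ℕ n → Vec ℕ (suc m)} → Computable f → Computable* h → Computable g →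
                Semi λ xs → θ (f xs) ∋ h xs ↦ g xs
  evaluationˢ {f = f} {g = g} {h = h} fᶜ hᶜ gᶜ = resp-⇔
    (λ xs → ⇔-sym (evaluation-enumerated (f xs) (h xs) (g xs)))
    (∃ˢ ⌞ app₁ (proj₁ (proj₂ qgn-I)) (var 0F)
        ≡ʳ pairᶠ (compose tuple-computable ((fᶜ ∷ᶜ hᶜ) ∘ᶜ tailᶜ)) (sucᶠ (compose gᶜ tailᶜ)) ⌟)
    where
    evaluation-enumerated : ∀ i x y →
      θ i ∋ x ↦ y ⇔ (∃[ t ] proj₁ qgn-I t ≡ ⟨ tuple (i ∷ x) , suc y ⟩)
    evaluation-enumerated i x y = mk⇔ fwd bwd
      where
      fwd : θ i ∋ x ↦ y → ⟨ tuple (i ∷ x) , suc y ⟩ ∈ Range (proj₁ qgn-I)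
      fwd θixy = proj₁ (proj₂ (proj₂ qgn-I)) (inj₂ (i ∷ x , y , θixy , refl))

      bwd : ⟨ tuple (i ∷ x) , suc y ⟩ ∈ Range (proj₁ qgn-I) → θ i ∋ x ↦ y
      bwd hit with proj₂ (proj₂ (proj₂ qgn-I)) hit
      -- Pairs with second component 0 carry no value and cannot match `suc y`.
      ... | inj₁ (_ , eq) = contradiction (proj₂ (⟨⟩-injective eq)) λ ()
      ... | inj₂ (x′ , y′ , θx′y′ , eq) with ⟨⟩-injective eq
      ...   | eq₁ , refl with tuple-injective (i ∷ x) x′ eq₁
      ...     | refl = θx′y′

  -- Arguments are replaced by their positions along `κ`, so a graph of any arity becomes a binary
  -- relation on numbers.
  Realizes : PFun (suc m) → (ℕ → ℕ → Set) → Set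
  Realizes r ρ = ∀ p y → r ∋ κ p ↦ y ⇔ ρ p y

  -- QGN II for a semirecursive graph instead of an enumeration of the extended graph.
  index : {R : ℕ → ℕ → ℕ → Set} →
          Semi {3} (λ xs → R (lookup xs 0F) (lookup xs 1F) (lookup xs 2F)) →
          ∃[ v ] Computable₁ v × (∀ i r → r ∈ 𝒮′ → Realizes r (R i) → r ≈ θ (v i))
  index {R} Rˢ =
    let (v , vᶜ , v-correct) = qgn-II k (computable₂ kᶜ)
    in v , vᶜ , λ i r r∈𝒮 real → v-correct i r r∈𝒮 (sub i r real , sup i r real)
    where
    stage : ℕ → ℕ → ℕ → ℕ → ℕ
    stage i p y t = char (recursive Rˢ) (t ∷ i ∷ p ∷ y ∷ [])

    -- Outputs the value `y`, shifted by one, if stage `t` confirms it, and the valueless pair for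
    -- `κ p` otherwise.
    k′ : ℕ → ℕ → ℕ → ℕ → ℕ
    k′ i p y t = ⟨ tuple (κ p) , ifZero (stage i p y t) (suc y) 0 ⟩

    k : ℕ → ℕ → ℕ
    k i z = k′ i (fst z) (fst (snd z)) (snd (snd z))

    kᶜ : Computable λ xs → k (lookup xs 0F) (lookup xs 1F)
    kᶜ = pairᶠ (compose tuple-computable (κᶜ (fstᶠ (var 1F))))
               (ifZeroᶠ (compose (char-computable (recursive Rˢ))
                                 (sndᶠ (sndᶠ (var 1F)) ∷ᶜ var 0F ∷ᶜ fstᶠ (var 1F)
                                   ∷ᶜ fstᶠ (sndᶠ (var 1F)) ∷ᶜ []ᶜ))
                        (sucᶠ (fstᶠ (sndᶠ (var 1F)))) (const 0))

    stage-sound : ∀ {i p y t} → stage i p y t ≡ 0 → R i p y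
    stage-sound eq = from (exhausts Rˢ _) (_ , from (char-correct (recursive Rˢ) _) eq)

    stage-complete : ∀ {i p y} → R i p y → ∃[ t ] stage i p y t ≡ 0
    stage-complete {i} {p} {y} Ripy =
      let (t , p) = to (exhausts Rˢ (i ∷ p ∷ y ∷ [])) Ripy
      in t , to (char-correct (recursive Rˢ) _) p

    k-⟨⟩ : ∀ i p y t → k i ⟨ p , ⟨ y , t ⟩ ⟩ ≡ k′ i p y t
    k-⟨⟩ i p y t = trans
      (cong₂ (λ a b → k′ i a (fst b) (snd b)) (fst-⟨⟩ p _) (snd-⟨⟩ p _))
      (cong₂ (k′ i p) (fst-⟨⟩ y t) (snd-⟨⟩ y t))

    k′∈Range : ∀ i p y t → k′ i p y t ∈ Range (k i)
    k′∈Range i p y t = ⟨ p , ⟨ y , t ⟩ ⟩ , k-⟨⟩ i p y t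

    sub : ∀ i r → Realizes r (R i) → Range (k i) ⊆ extGraph pairing r
    sub i r real (z , refl) with stage i (fst z) (fst (snd z)) (snd (snd z)) ≟ 0
    ... | yes eq = inj₂ (κ (fst z) , _ , from (real _ _) (stage-sound eq) ,
                         cong ⟨ _ ,_⟩ (ifZero-≡ eq))
    ... | no neq = inj₁ (κ (fst z) , cong ⟨ _ ,_⟩ (ifZero-≢ neq))

    -- A partial function cannot take both values 0 and 1 at a point.
    idle : ∀ i r → Realizes r (R i) → ∀ p → ∃[ y ] stage i p y 0 ≢ 0
    idle i r real p with stage i p 0 0 ≟ 0
    ... | no neq = 0 , neq
    ... | yes eq = 1 , λ eq′ → contradiction
      (PFun.functional r (from (real p 0) (stage-sound eq)) (from (real p 1) (stage-sound eq′)))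
      λ ()

    sup : ∀ i r → Realizes r (R i) → extGraph pairing r ⊆ Range (k i)
    sup i r real (inj₁ (x , refl)) =
      -- The valueless pair must be listed even where `r` is defined; a `y` unconfirmed at stage 0
      -- produces it.
      let (y , neq) = idle i r real (κ⁻¹ x)
      in subst (_∈ Range (k i)) (cong₂ (λ x c → ⟨ tuple x , c ⟩) (κ-κ⁻¹ x) (ifZero-≢ neq))
               (k′∈Range i (κ⁻¹ x) y 0)
    sup i r real (inj₂ (x , y , rxy , refl)) =
      let (t , eq) = stage-complete
                       (to (real (κ⁻¹ x) y) (subst (r ∋_↦ y) (sym (κ-κ⁻¹ x)) rxy))
      in subst (_∈ Range (k i)) (cong₂ (λ x c → ⟨ tuple x , c ⟩) (κ-κ⁻¹ x) (ifZero-≡ eq))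
               (k′∈Range i (κ⁻¹ x) y t)

  -- The diagonal halting set of `θ`

  Halt : Pred ℕ 0ℓ
  Halt i = θ i ∋ i ∷ replicate m 0 ↦ 0

  haltˢ : Semi {1} λ xs → Halt (lookup xs 0F)
  haltˢ = evaluationˢ (var 0F) (var 0F ∷ᶜ constᶜ (replicate m 0)) (const 0)

  -- Diagonalisation inside θ, which takes the place of a universal function.
  ¬Halt-not-semi : ¬ Semi {1} λ xs → ¬ Halt (lookup xs 0F)
  ¬Halt-not-semi ¬haltˢ =
    let (i , θi⊑ , ⊑θi) = surjective (total d) (inj₁ (d , dᶜ , id , id))
        Halt⇒¬Halt : Halt i → ¬ Halt i
        Halt⇒¬Halt h = from (char-correct ¬haltʳ (i ∷ [])) (θi⊑ h)
        ¬halt : ¬ Halt i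
        ¬halt h = Halt⇒¬Halt h h
    in ¬halt (⊑θi (to (char-correct ¬haltʳ (i ∷ [])) ¬halt))
    where
    ¬haltʳ : Recursive {1} λ xs → ¬ Halt (lookup xs 0F)
    ¬haltʳ = post-theorem ¬haltˢ haltˢ
      (λ xs → case em {Halt (lookup xs 0F)} of λ { (yes h) → inj₂ h ; (no ¬h) → inj₁ ¬h })
      (λ _ ¬h → ¬h)

    d : Vec ℕ (suc m) → ℕ
    d x = char ¬haltʳ (lookup x 0F ∷ [])

    dᶜ : Computable d
    dᶜ = compose (char-computable ¬haltʳ) (var 0F ∷ᶜ []ᶜ)

  -- Upward closure and compactness of completely c.e. sets

  module CompletelyEnumerable {X : Pred (PFun (suc m)) 0ℓ}
                              (X-resp : ∀ q r → q ≈ r → X q → X r)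
                              (X⊆𝒮 : X ⊆ 𝒮′) (X-ce : CompletelyCE θ X) where

    X-resp⇔ : ∀ q r → q ≈ r → X q ⇔ X r
    X-resp⇔ q r q≈r = mk⇔ (X-resp q r q≈r) (X-resp r q (≈-sym q r q≈r))

    -- QGN II turns such a family into a many-one reduction of the complement of `Halt` to the index
    -- set of `X`, making that complement semirecursive.
    inseparable : {R : ℕ → ℕ → ℕ → Set} →
                  Semi {3} (λ xs → R (lookup xs 0F) (lookup xs 1F) (lookup xs 2F)) →
                  (∀ i → Halt i → Σ[ r ∈ PFun (suc m) ] r ∈ 𝒮′ × Realizes r (R i) × ¬ X r) →
                  (∀ i → ¬ Halt i → Σ[ r ∈ PFun (suc m) ] r ∈ 𝒮′ × Realizes r (R i) × X r) →
                  ⊥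
    inseparable {R} Rˢ halting looping = ¬Halt-not-semi
      (resp-⇔ (λ xs → θv∈X (lookup xs 0F)) (substˢ (CE⇒Semi X-ce) (app₁ vᶜ (var 0F) ∷ᶜ []ᶜ)))
      where
      v  = proj₁ (index {R} Rˢ)
      vᶜ = proj₁ (proj₂ (index {R} Rˢ))

      v-correct : ∀ i r → r ∈ 𝒮′ → Realizes r (R i) → r ≈ θ (v i)
      v-correct = proj₂ (proj₂ (index {R} Rˢ))

      θv∈X : ∀ i → X (θ (v i)) ⇔ (¬ Halt i)
      θv∈X i = mk⇔
        (λ θvi∈X h → let (r , r∈𝒮 , real , r∉X) = halting i h
                         r≈θvi = v-correct i r r∈𝒮 real
                     in r∉X (from (X-resp⇔ r (θ (v i)) r≈θvi) θvi∈X))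
        (λ ¬h → let (r , r∈𝒮 , real , r∈X) = looping i ¬h
                    r≈θvi = v-correct i r r∈𝒮 real
                in to (X-resp⇔ r (θ (v i)) r≈θvi) r∈X)

    upward-closed : ∀ q r → q ⊑ r → r ∈ 𝒮′ → X q → X r
    upward-closed q r q⊑r r∈𝒮 q∈X with surjective q (X⊆𝒮 q∈X) | surjective r r∈𝒮
    ... | a , θa⊑q , q⊑θa | b , θb⊑r , r⊑θb = decidable-stable em λ r∉X → inseparable
      -- The inclusion of `q` in `r` keeps this union single-valued: it is `r` if `i` halts and `q`
      -- otherwise.
      {λ i p y → θ a ∋ κ p ↦ y ⊎ Halt i × θ b ∋ κ p ↦ y}
      (evaluationˢ (const a) (κᶜ (var 1F)) (var 2F) ⊎ˢ
       substˢ haltˢ (var 0F ∷ᶜ []ᶜ) ×ˢ evaluationˢ (const b) (κᶜ (var 1F)) (var 2F))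
      (λ i h → r , r∈𝒮 , (λ p y → mk⇔ (λ rpy → inj₂ (h , r⊑θb rpy))
                                      (λ { (inj₁ θa) → q⊑r (θa⊑q θa)
                                         ; (inj₂ (_ , θb)) → θb⊑r θb })) , r∉X)
      (λ i ¬h → q , X⊆𝒮 q∈X , (λ p y → mk⇔ (λ qpy → inj₁ (q⊑θa qpy))
                                      (λ { (inj₁ θa) → θa⊑q θa
                                         ; (inj₂ (h , _)) → contradiction h ¬h })) , q∈X)

    module Compactness {φ : ℕ → ℕ} (φᶜ : Computable₁ φ) (φ∈A : ∀ b → φ b ∈ A)
                       (φ-unbounded : ∀ s → ∃[ b ] s < φ b) where

      open Search {P = λ v → lookup v 1F < φ (lookup v 0F)}
                  (var 1F <ʳ app₁ φᶜ (var 0F)) (λ (xs : Vec ℕ 1) → φ-unbounded (lookup xs 0F))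

      side bound : ℕ → ℕ
      side s  = φ (search (s ∷ []))
      bound s = side s ^ suc m

      boundᶠ : Computable f → Computable λ xs → bound (f xs)
      boundᶠ fᶜ = app₁ φᶜ (compose search-computable (fᶜ ∷ᶜ []ᶜ)) ^ᶠ suc m

      -- The side is positive and exceeds `s`, and a positive number is at most its power with
      -- exponent `suc m`.
      <-bound : ∀ s → s < bound s
      <-bound s = <-≤-trans (search-solves (s ∷ []))
        (subst (_≤ bound s) (*-identityʳ (side s)) (*-monoʳ-≤ (side s) (m^n>0 (side s) m)))
        where
        instance
          side≢0 : NonZero (side s)
          side≢0 = >-nonZero (≤-<-trans z≤n (search-solves (s ∷ [])))

      restrict : PFun (suc m) → ℕ → PFun (suc m)
      restrict r a = record
        { _↦_ = λ x y → r ∋ x ↦ y × κ⁻¹ x < a ^ suc m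
        ; functional = λ (rxy , _) (rxz , _) → PFun.functional r rxy rxz }

      restrict∈Anf : ∀ r → r ∈ Rec (suc m) → ∀ b → restrict r (φ b) ∈ Anf A (suc m)
      restrict∈Anf r (g , _ , _ , g⊑r) b = inj₂ (φ b , φ∈A b ,
        (λ {x} (_ , _ , lt) → from (Cube⇔κ⁻¹< (φ b) x) lt) ,
        (λ {x} x∈ → g x , g⊑r refl , to (Cube⇔κ⁻¹< (φ b) x) x∈))

      HaltBy : ℕ → ℕ → Set
      HaltBy i s = Stage haltˢ (s ∷ i ∷ [])

      -- Every stage by which `i` has halted imposes a cut-off, and the smallest bound prevails;
      -- excluded middle allows minimising over all of them.
      tightest-bound : ∀ i → Halt i →
                       ∃[ s ] HaltBy i s × (∀ s′ → HaltBy i s′ → bound s ≤ bound s′)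
      tightest-bound i h =
        let (s₀ , h₀) = to (exhausts haltˢ (i ∷ [])) h
            (N , (s , hs , eq) , N-least) =
              least {P = λ N → ∃[ s ] HaltBy i s × bound s ≡ N}
                    (λ _ → em) (bound s₀ , s₀ , h₀ , refl)
        in s , hs , λ s′ h′ → ≮⇒≥ λ lt →
             N-least (bound s′) (subst (bound s′ <_) eq lt) (s′ , h′ , refl)

      -- Since s < bound s, only stages s ≤ p can cut off the point κ p, which makes the
      -- graph cut off at the tightest bound semirecursive.
      cutoff : ∀ r → r ∈ Rec (suc m) → X r →
               ∃[ b ] X (restrict r (φ b))
      cutoff r r-rec r∈X with surjective r (inj₁ r-rec)
      ... | a , θa⊑r , r⊑θa = decidable-stable em λ none → inseparable {Cut} Rˢ
        (λ i h → let (s , hs , s-min) = tightest-bound i h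
                 in restrict r (side s) , inj₂ (restrict∈Anf r r-rec _) ,
                    (λ p y → mk⇔
                      (λ (rpy , lt) → r⊑θa rpy , λ s′ _ (h′ , bound≤p) →
                         <⇒≱ (subst (_< bound s) (κ⁻¹-κ p) lt) (≤-trans (s-min s′ h′) bound≤p))
                      -- If `bound s ≤ p`, then `s < p` by `<-bound`, so the decisive stage `s` is
                      -- among those inspected at `p`.
                      (λ (θapy , ok) → θa⊑r θapy , subst (_< bound s) (sym (κ⁻¹-κ p))
                         (≰⇒> λ bound≤p → ok s (m<n⇒m<1+n (<-≤-trans (<-bound s) bound≤p))
                                            (hs , bound≤p)))) ,
                    λ X-restrict → none (_ , X-restrict))
        (λ i ¬h → r , inj₁ r-rec ,
                  (λ p y → mk⇔ (λ rpy → r⊑θa rpy ,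
                                  λ s _ (h , _) → ¬h (from (exhausts haltˢ (i ∷ [])) (s , h)))
                               (λ (θapy , _) → θa⊑r θapy)) ,
                  r∈X)
        where
        Cut : ℕ → ℕ → ℕ → Set
        Cut i p y = θ a ∋ κ p ↦ y × (∀ s → s < suc p → ¬ (HaltBy i s × bound s ≤ p))

        Rˢ : Semi {3} λ v → Cut (lookup v 0F) (lookup v 1F) (lookup v 2F)
        Rˢ = evaluationˢ (const a) (κᶜ (var 1F)) (var 2F)
          ×ˢ ⌞ ∀<ʳ (sucᶠ (var 1F))
                   (¬ʳ (substʳ (recursive haltˢ) (var 0F ∷ᶜ var 1F ∷ᶜ []ᶜ)
                     ×ʳ resp-⇔ʳ (λ _ → mk⇔ ≤-pred s≤s) (boundᶠ (var 0F) <ʳ sucᶠ (var 2F)))) ⌟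

-- Both directions of the equivalence

infinite⇒unbounded : ExcludedMiddle 0ℓ → ∀ {A φ} → Infinite A → A ≐ Range φ →
                     ∀ s → ∃[ b ] s < φ b
infinite⇒unbounded em {A} {φ} infinite (A⊆ , _) s = decidable-stable em λ ¬∃ →
  infinite (upTo (suc s) , λ a∈A → let (b , eq) = A⊆ a∈A in
    ∈-upTo⁺ (s≤s (subst (_≤ s) eq (≮⇒≥ λ s<φb → ¬∃ (b , s<φb)))))

theorem6p3 : ExcludedMiddle 0ℓ →
    (P : Pairing) (S : SequenceCoding)
    (m : ℕ) (K : CubeEnumeration (suc m))
    (A : Pred ℕ 0ℓ) → Infinite A → CE A →
    (f : ℕ → ℕ) → Computable₁ f → A ≐ Range f →
    (α : ℕ → PFun (suc m)) → IsCanonical P K S f α →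
    (θ : ℕ → PFun (suc m)) → IsQuasiGödel P A θ →
    (X : Pred (PFun (suc m)) 0ℓ) → X Respects _≈_ → X ⊆ 𝒮 A (suc m) →
    CompletelyCE θ X ⇔
    (∃[ C ] CE C ×
    X ≐ (λ r → r ∈ 𝒮 A (suc m) × (∃[ i ] i ∈ C × graph P (α i) ⊆ graph P r)))
theorem6p3 em P S m K A infinite _ f fᶜ A≐f α can θ qgn X X-resp X⊆𝒮 = mk⇔ only-if if
  where
  open CubeEnumeration K using (κ)
  open Tuples P
  open Tables K
  open Canonical em P S K fᶜ can
  open QuasiGödel em P K qgn
  open IsQuasiGödel qgn using (isNumbering)
  open IsNumbering isNumbering using (into)

  Basis : Pred ℕ 0ℓ → Pred (PFun (suc m)) 0ℓ
  Basis C r = r ∈ 𝒮 A (suc m) × (∃[ i ] i ∈ C × graph P (α i) ⊆ graph P r)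

  only-if : CompletelyCE θ X → ∃[ C ] CE C × X ≐ Basis C
  only-if X-ce = X ∘ α , Semi⇒CE em P indicesˢ , X⊆Basis , Basis⊆X
    where
    open CompletelyEnumerable (λ q r → X-resp {q} {r}) X⊆𝒮 X-ce
    open Compactness fᶜ (λ b → proj₂ A≐f (b , refl)) (infinite⇒unbounded em infinite A≐f)

    -- The tables of `α` are uniformly computable, so `α i` has a `θ`-index computable from `i`;
    -- this pulls the c.e. index set of `X` back to `X ∘ α`.
    α-index : ∃[ v ] Computable₁ v × (∀ i r → r ∈ 𝒮 A (suc m) →
                Realizes r (λ p y → p < size i × y ≡ value i p) → r ≈ θ (v i))
    α-index = index {λ i p y → p < size i × y ≡ value i p}
      ⌞ (var 1F <ʳ sizeᶠ (var 0F)) ×ʳ (var 2F ≡ʳ valueᶠ (var 0F) (var 1F)) ⌟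

    indicesˢ : Semi {1} λ xs → X (α (lookup xs 0F))
    indicesˢ =
      let (v , vᶜ , α≈θv) = α-index
      in resp-⇔ (λ xs → let i = lookup xs 0F in ⇔-sym (X-resp⇔ (α i) (θ (v i))
                   (α≈θv i (α i) (inj₂ (α∈Anf A≐f i)) (table-κ (α-table i)))))
                (substˢ (CE⇒Semi X-ce) (app₁ vᶜ (var 0F) ∷ᶜ []ᶜ))

    finite-part : ∀ q r → q ∈ Anf A (suc m) → q ⊑ r → X q → ∃[ i ] X (α i) × α i ⊑ r
    finite-part q r q∈Anf q⊑r q∈X =
      let (i , αi⊑q , q⊑αi) = Anf⊆α A≐f q q∈Anf
      in i , from (X-resp⇔ (α i) q (αi⊑q , q⊑αi)) q∈X , q⊑r ∘ αi⊑q

    compact : ∀ r → X r → ∃[ i ] X (α i) × α i ⊑ r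
    compact r r∈X with X⊆𝒮 r∈X
    ... | inj₁ r-rec = let (b , X-restrict) = cutoff r r-rec r∈X
                       in finite-part (restrict r (f b)) r (restrict∈Anf r r-rec b) proj₁ X-restrict
    -- A finite function is its own finite part.
    ... | inj₂ r∈Anf = finite-part r r r∈Anf id r∈X

    X⊆Basis : X ⊆ Basis (X ∘ α)
    X⊆Basis {r} r∈X = let (i , αi∈X , αi⊑r) = compact r r∈X
                      in X⊆𝒮 r∈X , i , αi∈X , graph-⊆⁺ (α i) r αi⊑r

    Basis⊆X : Basis (X ∘ α) ⊆ X
    Basis⊆X {r} (r∈𝒮 , i , αi∈X , sub) =
      upward-closed (α i) r (graph-⊆⁻ (α i) r sub) r∈𝒮 αi∈X

  if : (∃[ C ] CE C × X ≐ Basis C) → CompletelyCE θ X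
  if (C , C-ce , X⊆Basis , Basis⊆X) = Semi⇒CE em P
    (resp-⇔ (λ xs → below⇔∈X (lookup xs 0F))
      -- Search for `c` in `C` such that the finitely many entries of `α c` are all confirmed as
      -- values of `θ i`; the innermost variables are `p`, `c`, `i` in this order.
      (∃ˢ (substˢ (CE⇒Semi C-ce) (var 0F ∷ᶜ []ᶜ) ×ˢ
           ∀<ˢ (sizeᶠ (var 0F))
               (evaluationˢ (var 2F) (κᶜ (var 0F)) (valueᶠ (var 1F) (var 0F))))))
    where
    below⇔∈X : ∀ i → (∃[ c ] C c × (∀ p → p < size c → θ i ∋ κ p ↦ value c p)) ⇔ X (θ i)
    below⇔∈X i = mk⇔
      (λ (c , c∈C , h) → Basis⊆X (into i , c , c∈C ,
         graph-⊆⁺ (α c) (θ i) (from (table-⊑ (α-table c) (θ i)) h)))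
      (λ θi∈X → let (_ , c , c∈C , sub) = X⊆Basis θi∈X
                in c , c∈C , to (table-⊑ (α-table c) (θ i)) (graph-⊆⁻ (α c) (θ i) sub))
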